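{- Let $\nu$ be a lattice path, let $N_\nu(x)$ be its $\nu$-Narayana polynomial, and let $\mathtt{sch}_\nu(i)$ denote the number of $\nu$-Schröder paths with exactly $i$ diagonal steps. Then $$N_\nu(x+1) = \sum_{i\geq 0} \mathtt{sch}_\nu(i)\, x^i.$$
   Context: A lattice path from $(0,0)$ to $(b,a)\in\mathbb{Z}_{\ge 0}^2$ is a sequence of $a$ north steps $N=(0,1)$ and $b$ east steps $E=(1,0)$. Let $\nu$ be such a path. A $\nu$-Dyck path is a lattice path from $(0,0)$ to $(b,a)$ which stays weakly above $\nu$. A $\nu$-Schröder path is a path from $(0,0)$ to $(b,a)$ with steps $N=(0,1)$, $E=(1,0)$, $D=(1,1)$ (diagonal) which stays weakly above $\nu$. A valley of a lattice path is a consecutive pair $EN$ of steps. The $i$-th $\nu$-Narayana number $\mathtt{Nar}_\nu(i)$ is the number of $\nu$-Dyck paths with exactly $i$ valleys, and the $\nu$-Narayana polynomial is $N_\nu(x)=\sum_{i\ge 0}\mathtt{Nar}_\nu(i)x^i$. -}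

module Defs where

open import Data.Nat using (ℕ; zero; suc; _+_; _*_; _≤_; _<_; z≤n; s≤s)
open import Data.Nat.Properties
open import Data.Empty using (⊥)
open import Data.List.Base using (List; []; _∷_; map; _++_; length; filter; applyUpTo)
open import Data.List.Properties using (∷-injectiveʳ; filter-none)
open import Data.List.Membership.Propositional using (_∈_)
open import Data.List.Membership.Propositional.Properties
  using (∈-map⁺; ∈-map⁻; ∈-++⁺ˡ; ∈-++⁺ʳ; ∈-++⁻; ∈-filter⁻)
open import Data.List.Relation.Unary.Any using (here)
open import Data.List.Relation.Unary.All as All using (All)
open import Data.List.Relation.Unary.AllPairs using ([]; _∷_)
open import Data.List.Relation.Unary.Unique.Propositional using (Unique)
import Data.List.Relation.Unary.Unique.Propositional.Properties as Unique
open import Data.List.Relation.Binary.Pointwise using (Pointwise; decidable)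
open import Data.Product using (_×_; _,_; proj₁)
open import Data.Sum using (inj₁; inj₂)
open import Relation.Nullary using (Dec)
open import Relation.Binary.PropositionalEquality using (_≡_; refl; cong; sym)

data Kind : Set where
  lattice schröder : Kind

data Step : Kind → Set where
  N E : ∀ {k} → Step k
  D   : Step schröder

Path : Kind → Set
Path k = List (Step k)

LatticePath : Set
LatticePath = Path lattice

-- A path starting at (0,0) ends at (width p , height p).
width : ∀ {k} → Path k → ℕ
width []      = 0
width (N ∷ p) = width p
width (E ∷ p) = suc (width p)
width (D ∷ p) = suc (width p)

height : ∀ {k} → Path k → ℕ
height []      = 0
height (N ∷ p) = suc (height p)
height (E ∷ p) = height p
height (D ∷ p) = suc (height p)

-- For a path starting at ordinate y, the i-th entry is the ordinate at which
-- the path begins its step across the vertical strip i < x < i + 1.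
crossings : ∀ {k} → ℕ → Path k → List ℕ
crossings y []      = []
crossings y (N ∷ p) = crossings (suc y) p
crossings y (E ∷ p) = y ∷ crossings y p
crossings y (D ∷ p) = y ∷ crossings (suc y) p

-- Over a strip i < x < i + 1 the lattice path ν is horizontal, at height h say,
-- and p is either horizontal at height y or a diagonal with points
-- (i + t , y + t), 0 < t < 1.  As h and y are integers, in both cases p is
-- weakly above ν over the strip exactly when h ≤ y.  In particular a D step
-- may not cut the corner of a consecutive pair N E of ν, although both of its
-- endpoints then lie on ν, so comparing only the lattice points would be wrong.
-- The vertical lines x = i add no condition, since both paths are connected and
-- start at (0,0).
WeaklyAbove : ∀ {k} → LatticePath → Path k → Set
WeaklyAbove ν p = Pointwise _≤_ (crossings 0 ν) (crossings 0 p)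

weaklyAbove? : ∀ {k} (ν : LatticePath) (p : Path k) → Dec (WeaklyAbove ν p)
weaklyAbove? ν p = decidable _≤?_ (crossings 0 ν) (crossings 0 p)

prependD : ∀ k → List (Path k) → List (Path k)
prependD lattice  ps = []
prependD schröder ps = map (D ∷_) ps

-- All paths from (0,0) to (b,a), each exactly once: see ∈-paths⁺, ∈-paths⁻
-- and paths-unique below.
paths : ∀ k (b a : ℕ) → List (Path k)
paths k zero    zero    = [] ∷ []
paths k zero    (suc a) = map (N ∷_) (paths k zero a)
paths k (suc b) zero    = map (E ∷_) (paths k b zero)
paths k (suc b) (suc a) = map (N ∷_) (paths k (suc b) a)
                       ++ map (E ∷_) (paths k b (suc a))
                       ++ prependD k (paths k b a)

pathsAbove : ∀ k → LatticePath → List (Path k)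
pathsAbove k ν = filter (weaklyAbove? ν) (paths k (width ν) (height ν))

dyckPaths : LatticePath → List (Path lattice)
dyckPaths = pathsAbove lattice

schröderPaths : LatticePath → List (Path schröder)
schröderPaths = pathsAbove schröder

valleys : LatticePath → ℕ
valleys []          = 0
valleys (E ∷ N ∷ p) = suc (valleys (N ∷ p))
valleys (_ ∷ p)     = valleys p

diagonals : ∀ {k} → Path k → ℕ
diagonals []      = 0
diagonals (N ∷ p) = diagonals p
diagonals (E ∷ p) = diagonals p
diagonals (D ∷ p) = suc (diagonals p)

Nar : LatticePath → ℕ → ℕ
Nar ν i = length (filter (λ p → valleys p ≟ i) (dyckPaths ν))

sch : LatticePath → ℕ → ℕ
sch ν i = length (filter (λ p → diagonals p ≟ i) (schröderPaths ν))

-- Polynomials in one variable over ℕ, as coefficient lists with the constant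
-- term first.  Trailing zeros are allowed, so equality is _≈ₚ_ and not _≡_.
Poly : Set
Poly = List ℕ

coeff : Poly → ℕ → ℕ
coeff []      _       = 0
coeff (c ∷ p) zero    = c
coeff (c ∷ p) (suc i) = coeff p i

infix 4 _≈ₚ_
_≈ₚ_ : Poly → Poly → Set
p ≈ₚ q = ∀ i → coeff p i ≡ coeff q i

infixl 6 _+ₚ_
_+ₚ_ : Poly → Poly → Poly
[]      +ₚ q       = q
p       +ₚ []      = p
(c ∷ p) +ₚ (d ∷ q) = (c + d) ∷ (p +ₚ q)

infixl 7 _*ₚ_
_*ₚ_ : Poly → Poly → Poly
[]      *ₚ q = []
(c ∷ p) *ₚ q = map (c *_) q +ₚ (0 ∷ p *ₚ q)

const : ℕ → Poly
const c = c ∷ []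

X : Poly
X = 0 ∷ 1 ∷ []

-- p ⟨ q ⟩ is the composite p(q(x)).
infixl 8 _⟨_⟩
_⟨_⟩ : Poly → Poly → Poly
[]      ⟨ q ⟩ = []
(c ∷ p) ⟨ q ⟩ = const c +ₚ q *ₚ p ⟨ q ⟩

-- The sums over all i ≥ 0 are cut off at i = length ν, beyond which Nar ν i
-- and sch ν i vanish: see coeff-narayanaPoly and coeff-schröderPoly below.
narayanaPoly : LatticePath → Poly
narayanaPoly ν = applyUpTo (Nar ν) (suc (length ν))

schröderPoly : LatticePath → Poly
schröderPoly ν = applyUpTo (sch ν) (suc (length ν))

∈-paths⁺ : ∀ {k} (p : Path k) → p ∈ paths k (width p) (height p)
∈-paths⁺ []      = here refl
∈-paths⁺ (N ∷ p) with width p | ∈-paths⁺ p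
... | zero  | i = ∈-map⁺ (N ∷_) i
... | suc b | i = ∈-++⁺ˡ (∈-map⁺ (N ∷_) i)
∈-paths⁺ (E ∷ p) with height p | ∈-paths⁺ p
... | zero  | i = ∈-map⁺ (E ∷_) i
... | suc a | i = ∈-++⁺ʳ (map (N ∷_) (paths _ (suc (width p)) a)) (∈-++⁺ˡ (∈-map⁺ (E ∷_) i))
∈-paths⁺ (D ∷ p) =
  ∈-++⁺ʳ (map (N ∷_) (paths _ (suc (width p)) (height p)))
    (∈-++⁺ʳ (map (E ∷_) (paths _ (width p) (suc (height p))))
      (∈-map⁺ (D ∷_) (∈-paths⁺ p)))

∈-paths⁻ : ∀ k b a {p : Path k} → p ∈ paths k b a → width p ≡ b × height p ≡ a
∈-paths⁻ k zero    zero    (here refl) = refl , refl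
∈-paths⁻ k zero    (suc a) i with ∈-map⁻ (N ∷_) i
... | _ , j , refl with ∈-paths⁻ k zero a j
...   | w , h = w , cong suc h
∈-paths⁻ k (suc b) zero    i with ∈-map⁻ (E ∷_) i
... | _ , j , refl with ∈-paths⁻ k b zero j
...   | w , h = cong suc w , h
∈-paths⁻ k (suc b) (suc a) i with ∈-++⁻ (map (N ∷_) (paths k (suc b) a)) i
... | inj₁ i₁ with ∈-map⁻ (N ∷_) i₁
...   | _ , j , refl with ∈-paths⁻ k (suc b) a j
...     | w , h = w , cong suc h
∈-paths⁻ k (suc b) (suc a) i | inj₂ i₂ with ∈-++⁻ (map (E ∷_) (paths k b (suc a))) i₂
... | inj₁ i₃ with ∈-map⁻ (E ∷_) i₃
...   | _ , j , refl with ∈-paths⁻ k b (suc a) j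
...     | w , h = cong suc w , h
∈-paths⁻ schröder (suc b) (suc a) i | inj₂ i₂ | inj₂ i₃ with ∈-map⁻ (D ∷_) i₃
...   | _ , j , refl with ∈-paths⁻ schröder b a j
...     | w , h = cong suc w , cong suc h

paths-unique : ∀ k b a → Unique (paths k b a)
paths-unique k zero    zero    = All.[] ∷ []
paths-unique k zero    (suc a) = Unique.map⁺ ∷-injectiveʳ (paths-unique k zero a)
paths-unique k (suc b) zero    = Unique.map⁺ ∷-injectiveʳ (paths-unique k b zero)
paths-unique k (suc b) (suc a) =
  Unique.++⁺ (Unique.map⁺ ∷-injectiveʳ (paths-unique k (suc b) a))
    (Unique.++⁺ (Unique.map⁺ ∷-injectiveʳ (paths-unique k b (suc a)))
      (D-unique k (paths-unique k b a)) (λ (i , j) → E≢D k i j))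
    λ (i , j) → N≢ED k i j
  where
  D-unique : ∀ k {ps} → Unique ps → Unique (prependD k ps)
  D-unique lattice  u = []
  D-unique schröder u = Unique.map⁺ ∷-injectiveʳ u

  E≢D : ∀ k {p ps qs} → p ∈ map (E ∷_) ps → p ∈ prependD k qs → ⊥
  E≢D schröder i j with ∈-map⁻ (E ∷_) i | ∈-map⁻ (D ∷_) j
  ... | _ , _ , refl | _ , _ , ()

  N≢D : ∀ k {p ps qs} → p ∈ map (N ∷_) ps → p ∈ prependD k qs → ⊥
  N≢D schröder i j with ∈-map⁻ (N ∷_) i | ∈-map⁻ (D ∷_) j
  ... | _ , _ , refl | _ , _ , ()

  N≢ED : ∀ k {p ps qs rs} → p ∈ map (N ∷_) ps →
         p ∈ map (E ∷_) qs ++ prependD k rs → ⊥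
  N≢ED k {qs = qs} i j with ∈-++⁻ (map (E ∷_) qs) j
  ... | inj₂ j₂ = N≢D k i j₂
  ... | inj₁ j₁ with ∈-map⁻ (N ∷_) i | ∈-map⁻ (E ∷_) j₁
  ...   | _ , _ , refl | _ , _ , ()

valleys≤width : ∀ p → valleys p ≤ width p
valleys≤width []          = z≤n
valleys≤width (N ∷ p)     = valleys≤width p
valleys≤width (E ∷ [])    = z≤n
valleys≤width (E ∷ E ∷ p) = m≤n⇒m≤1+n (valleys≤width (E ∷ p))
valleys≤width (E ∷ N ∷ p) = s≤s (valleys≤width (N ∷ p))

diagonals≤width : ∀ {k} (p : Path k) → diagonals p ≤ width p
diagonals≤width []      = z≤n
diagonals≤width (N ∷ p) = diagonals≤width p
diagonals≤width (E ∷ p) = m≤n⇒m≤1+n (diagonals≤width p)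
diagonals≤width (D ∷ p) = s≤s (diagonals≤width p)

width≤length : ∀ {k} (p : Path k) → width p ≤ length p
width≤length []      = z≤n
width≤length (N ∷ p) = m≤n⇒m≤1+n (width≤length p)
width≤length (E ∷ p) = s≤s (width≤length p)
width≤length (D ∷ p) = s≤s (width≤length p)

vanish : ∀ k ν (f : Path k → ℕ) → (∀ p → f p ≤ width p) →
         ∀ i → length ν < i → length (filter (λ p → f p ≟ i) (pathsAbove k ν)) ≡ 0
vanish k ν f f≤w i ν<i =
  cong length (filter-none (λ p → f p ≟ i) (All.tabulate λ {p} p∈ fp≡i →
    <⇒≢ (≤-<-trans (≤-trans (f≤w p)
           (≤-trans (≤-reflexive (proj₁ (∈-paths⁻ k (width ν) (height ν)
              (proj₁ (∈-filter⁻ (weaklyAbove? ν) {xs = paths k (width ν) (height ν)} p∈)))))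
            (width≤length ν))) ν<i) fp≡i))

coeff-applyUpTo : ∀ (f : ℕ → ℕ) n → (∀ i → n ≤ i → f i ≡ 0) →
                  ∀ i → coeff (applyUpTo f n) i ≡ f i
coeff-applyUpTo f zero    z i       = sym (z i z≤n)
coeff-applyUpTo f (suc n) z zero    = refl
coeff-applyUpTo f (suc n) z (suc i) =
  coeff-applyUpTo (λ j → f (suc j)) n (λ j n≤j → z (suc j) (s≤s n≤j)) i

coeff-narayanaPoly : ∀ ν i → coeff (narayanaPoly ν) i ≡ Nar ν i
coeff-narayanaPoly ν =
  coeff-applyUpTo (Nar ν) (suc (length ν)) (vanish lattice ν valleys valleys≤width)

coeff-schröderPoly : ∀ ν i → coeff (schröderPoly ν) i ≡ sch ν i
coeff-schröderPoly ν =
  coeff-applyUpTo (sch ν) (suc (length ν)) (vanish schröder ν diagonals diagonals≤width)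

-- Replacing every D of a Schröder path by E N keeps its ordinates over the
-- vertical strips, hence its position relative to ν, and turns it into a lattice
-- path some of whose valleys are marked.  So the Schröder paths with i diagonals
-- correspond to the pairs (Dyck path p, i-subset of its valleys), which gives
-- sch ν i = Σ_p C(valleys p, i), the coefficient of x^i in Σ_p (x + 1)^(valleys p).
module Submission where

open import Defs
open import Algebra.Properties.CommutativeSemigroup using (interchange)
open import Data.Bool.Base using (if_then_else_)
open import Data.List.Base
  using (List; []; _∷_; map; _++_; length; filter; applyUpTo; upTo)
open import Data.List.Properties using (map-∘; map-cong; map-++; map-applyUpTo)
open import Data.List.Membership.Propositional.Properties using (∈-filter⁻)
open import Data.List.Relation.Binary.Pointwise using (decidable)
open import Data.List.Relation.Unary.All as All using (All)
open import Data.Nat using (ℕ; zero; suc; _+_; _*_; _<_; s≤s)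
open import Data.Nat.Combinatorics using (_C_; nCk+nC[k+1]≡[n+1]C[k+1])
open import Data.Nat.ListAction using (sum)
open import Data.Nat.ListAction.Properties using (sum-++)
open import Data.Nat.Properties
open import Data.Product using (proj₁)
open import Function using (_∘_; id)
open import Relation.Binary.PropositionalEquality
open import Relation.Nullary using (Dec; yes; no; does)
open import Relation.Unary using (Decidable)

open ≡-Reasoning

private
  variable
    A B : Set

-- Finite sums over lists, and indicators.

Σ : (A → ℕ) → List A → ℕ
Σ f xs = sum (map f xs)

Σ-cong : ∀ {f g : A → ℕ} → f ≗ g → ∀ xs → Σ f xs ≡ Σ g xs
Σ-cong f≗g xs = cong sum (map-cong f≗g xs)

Σ-map : ∀ (f : B → ℕ) (h : A → B) xs → Σ f (map h xs) ≡ Σ (f ∘ h) xs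
Σ-map f h xs = cong sum (sym (map-∘ xs))

Σ-++ : ∀ (f : A → ℕ) xs ys → Σ f (xs ++ ys) ≡ Σ f xs + Σ f ys
Σ-++ f xs ys = trans (cong sum (map-++ f xs ys)) (sum-++ (map f xs) (map f ys))

Σ-+ : ∀ (f g : A → ℕ) xs → Σ (λ x → f x + g x) xs ≡ Σ f xs + Σ g xs
Σ-+ f g []       = refl
Σ-+ f g (x ∷ xs) =
  trans (cong (f x + g x +_) (Σ-+ f g xs))
        (interchange +-commutativeSemigroup (f x) (g x) (Σ f xs) (Σ g xs))

Σ-zero : ∀ (f : A → ℕ) → (∀ x → f x ≡ 0) → ∀ xs → Σ f xs ≡ 0
Σ-zero f z []       = refl
Σ-zero f z (x ∷ xs) = cong₂ _+_ (z x) (Σ-zero f z xs)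

Σ-upTo-suc : ∀ (f : ℕ → ℕ) n → Σ f (upTo (suc n)) ≡ f 0 + Σ (f ∘ suc) (upTo n)
Σ-upTo-suc f n = cong (f 0 +_)
  (trans (cong (Σ f) (sym (map-applyUpTo id suc n))) (Σ-map f suc (upTo n)))

-- Only `does` is inspected, so for equality of naturals the value at `suc m` and `suc n` reduces to
-- that at `m` and `n`.
⟦_⟧ : ∀ {P : Set} → Dec P → ℕ
⟦ P? ⟧ = if does P? then 1 else 0

Σ-filter : ∀ {P : A → Set} (P? : Decidable P) (f : A → ℕ) xs →
           Σ f (filter P? xs) ≡ Σ (λ x → ⟦ P? x ⟧ * f x) xs
Σ-filter P? f []       = refl
Σ-filter P? f (x ∷ xs) with P? x
... | yes _ = cong₂ _+_ (sym (+-identityʳ (f x))) (Σ-filter P? f xs)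
... | no  _ = Σ-filter P? f xs

length-filter : ∀ {P : A → Set} (P? : Decidable P) xs →
                length (filter P? xs) ≡ Σ (λ x → ⟦ P? x ⟧) xs
length-filter P? []       = refl
length-filter P? (x ∷ xs) with P? x
... | yes _ = cong suc (length-filter P? xs)
... | no  _ = length-filter P? xs

-- Kronecker delta and Pascal's rule.

δ : ℕ → ℕ → ℕ
δ m n = ⟦ m ≟ n ⟧

-- On coefficient sequences, multiplication by x.
shift : (ℕ → ℕ) → ℕ → ℕ
shift f zero    = 0
shift f (suc i) = f i

0C≡δ : ∀ i → 0 C i ≡ δ 0 i
0C≡δ zero    = refl
0C≡δ (suc i) = refl

δ-suc : ∀ m i → δ (suc m) i ≡ shift (δ m) i
δ-suc m zero    = refl
δ-suc m (suc i) = refl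

-- The coefficients of (x + 1)^n + x (x + 1)^n; writing the second term with `shift` covers `i = 0`
-- as well.
pascal : ∀ n i → suc n C i ≡ n C i + shift (n C_) i
pascal n zero    = refl
pascal n (suc i) =
  trans (sym (nCk+nC[k+1]≡[n+1]C[k+1] n i)) (+-comm (n C i) (n C suc i))

Σ-pascal : ∀ (c v : A → ℕ) i xs →
  Σ (λ x → c x * (suc (v x) C i)) xs ≡
  Σ (λ x → c x * (v x C i)) xs + Σ (λ x → c x * shift (v x C_) i) xs
Σ-pascal c v i xs = trans
  (Σ-cong (λ x → trans (cong (c x *_) (pascal (v x) i)) (*-distribˡ-+ (c x) _ _)) xs)
  (Σ-+ (λ x → c x * (v x C i)) (λ x → c x * shift (v x C_) i) xs)

-- Marked valleys against diagonal steps, by recursion on the end point.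

Σ-paths : ∀ k (f : Path k → ℕ) b a →
  Σ f (paths k (suc b) (suc a)) ≡
  Σ (f ∘ (N ∷_)) (paths k (suc b) a) +
    (Σ (f ∘ (E ∷_)) (paths k b (suc a)) + Σ f (prependD k (paths k b a)))
Σ-paths k f b a = trans
  (Σ-++ f (map (N ∷_) ns) (map (E ∷_) es ++ ds))
  (cong₂ _+_ (Σ-map f (N ∷_) ns)
    (trans (Σ-++ f (map (E ∷_) es) ds) (cong (_+ Σ f ds) (Σ-map f (E ∷_) es))))
  where
  ns = paths k (suc b) a
  es = paths k b (suc a)
  ds = prependD k (paths k b a)

-- In the E-step of the recursion a valley appears only in front of N, and
-- marking it accounts for the second sum: these are the D-steps.
Σ-valleys-E∷ : ∀ (c : LatticePath → ℕ) i b a →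
  Σ (λ p → c p * (valleys (E ∷ p) C i)) (paths lattice b (suc a)) ≡
  Σ (λ p → c p * (valleys p C i)) (paths lattice b (suc a)) +
  Σ (λ p → c (N ∷ p) * shift (valleys p C_) i) (paths lattice b a)
Σ-valleys-E∷ c i zero a = begin
  Σ u (map (N ∷_) ps)                            ≡⟨ Σ-map u (N ∷_) ps ⟩
  Σ (λ p → c (N ∷ p) * (suc (valleys p) C i)) ps ≡⟨ Σ-pascal (c ∘ (N ∷_)) valleys i ps ⟩
  Σ (w ∘ (N ∷_)) ps + d                          ≡⟨ cong (_+ d) (Σ-map w (N ∷_) ps) ⟨
  Σ w (map (N ∷_) ps) + d                        ∎
  where
  ps = paths lattice zero a
  u  = λ p → c p * (valleys (E ∷ p) C i)
  w  = λ p → c p * (valleys p C i)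
  d  = Σ (λ p → c (N ∷ p) * shift (valleys p C_) i) ps
Σ-valleys-E∷ c i (suc b) a = begin
  Σ u (paths lattice (suc b) (suc a))
    ≡⟨ Σ-paths lattice u b a ⟩
  Σ (λ p → c (N ∷ p) * (suc (valleys p) C i)) ps + e
    ≡⟨ cong (_+ e) (Σ-pascal (c ∘ (N ∷_)) valleys i ps) ⟩
  Σ (w ∘ (N ∷_)) ps + d + e
    ≡⟨ +-assoc (Σ (w ∘ (N ∷_)) ps) d e ⟩
  Σ (w ∘ (N ∷_)) ps + (d + e)
    ≡⟨ cong (Σ (w ∘ (N ∷_)) ps +_) (+-comm d e) ⟩
  Σ (w ∘ (N ∷_)) ps + (e + d)
    ≡⟨ +-assoc (Σ (w ∘ (N ∷_)) ps) e d ⟨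
  Σ (w ∘ (N ∷_)) ps + e + d
    ≡⟨ cong (_+ d) (Σ-paths lattice w b a) ⟨
  Σ w (paths lattice (suc b) (suc a)) + d ∎
  where
  ps = paths lattice (suc b) a
  u  = λ p → c p * (valleys (E ∷ p) C i)
  w  = λ p → c p * (valleys p C i)
  d  = Σ (λ p → c (N ∷ p) * shift (valleys p C_) i) ps
  -- Here `u` and `w` agree, since `valleys (E ∷ E ∷ p)` reduces to `valleys (E ∷ p)`. The `0` is
  -- the empty sum over `prependD lattice`.
  e  = Σ (w ∘ (E ∷_)) (paths lattice b (suc a)) + 0

-- A path of height 0 has no N step, so an E in front creates no valley.
Σ-valleys-E∷-flat : ∀ (c : LatticePath → ℕ) i b →
  Σ (λ p → c p * (valleys (E ∷ p) C i)) (paths lattice b 0) ≡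
  Σ (λ p → c p * (valleys p C i)) (paths lattice b 0)
Σ-valleys-E∷-flat c i zero    = refl
Σ-valleys-E∷-flat c i (suc b) = trans
  (Σ-map (λ p → c p * (valleys (E ∷ p) C i)) (E ∷_) (paths lattice b 0))
  (sym (Σ-map (λ p → c p * (valleys p C i)) (E ∷_) (paths lattice b 0)))

-- Multiplying both generating functions by x preserves their equality: all terms vanish at `i = 0`,
-- and the rest is the hypothesis one degree lower. It carries the induction hypothesis past a
-- marked valley or a D step.
Σ-shift : ∀ (c : A → ℕ) (f : A → ℕ → ℕ) xs (d : B → ℕ) (g : B → ℕ → ℕ) ys →
  (∀ i → Σ (λ x → c x * f x i) xs ≡ Σ (λ y → d y * g y i) ys) →
  ∀ i → Σ (λ x → c x * shift (f x) i) xs ≡ Σ (λ y → d y * shift (g y) i) ys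
Σ-shift c f xs d g ys eq zero =
  trans (Σ-zero _ (*-zeroʳ ∘ c) xs) (sym (Σ-zero _ (*-zeroʳ ∘ d) ys))
Σ-shift c f xs d g ys eq (suc i) = eq i

-- The constraint of lying above ν enters only through the weight g, which makes
-- the induction independent of ν.
valleys-diagonals : ∀ (g : List ℕ → ℕ) y b a i →
  Σ (λ p → g (crossings y p) * (valleys p C i)) (paths lattice b a) ≡
  Σ (λ p → g (crossings y p) * δ (diagonals p) i) (paths schröder b a)
valleys-diagonals g y zero zero i = cong (λ n → g [] * n + 0) (0C≡δ i)
valleys-diagonals g y zero (suc a) i = begin
  Σ _ (map (N ∷_) (paths lattice zero a))  ≡⟨ Σ-map _ (N ∷_) (paths lattice zero a) ⟩
  _                                        ≡⟨ valleys-diagonals g (suc y) zero a i ⟩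
  _                                        ≡⟨ Σ-map _ (N ∷_) (paths schröder zero a) ⟨
  Σ _ (map (N ∷_) (paths schröder zero a)) ∎
valleys-diagonals g y (suc b) zero i = begin
  Σ _ (map (E ∷_) (paths lattice b zero))  ≡⟨ Σ-map _ (E ∷_) (paths lattice b zero) ⟩
  _                                        ≡⟨ Σ-valleys-E∷-flat (λ p → g (y ∷ crossings y p)) i b ⟩
  _                                        ≡⟨ valleys-diagonals (g ∘ (y ∷_)) y b zero i ⟩
  _                                        ≡⟨ Σ-map _ (E ∷_) (paths schröder b zero) ⟨
  Σ _ (map (E ∷_) (paths schröder b zero)) ∎
valleys-diagonals g y (suc b) (suc a) i = begin
  Σ u (paths lattice (suc b) (suc a))
    ≡⟨ Σ-paths lattice u b a ⟩
  Σ (u ∘ (N ∷_)) (paths lattice (suc b) a) +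
    (Σ (u ∘ (E ∷_)) (paths lattice b (suc a)) + 0)
    ≡⟨ cong₂ _+_ (valleys-diagonals g (suc y) (suc b) a i) east ⟩
  Σ (w ∘ (N ∷_)) (paths schröder (suc b) a) +
    (Σ (w ∘ (E ∷_)) (paths schröder b (suc a)) + Σ w (map (D ∷_) (paths schröder b a)))
    ≡⟨ Σ-paths schröder w b a ⟨
  Σ w (paths schröder (suc b) (suc a)) ∎
  where
  u : LatticePath → ℕ
  u p = g (crossings y p) * (valleys p C i)
  w : Path schröder → ℕ
  w p = g (crossings y p) * δ (diagonals p) i
  -- A marked valley E N and a step D both record the crossing `y` and continue from ordinate
  -- `suc y`, so the induction hypothesis applies with the weight `g ∘ (y ∷_)`.
  diagonal : Σ (λ p → g (y ∷ crossings (suc y) p) * shift (valleys p C_) i) (paths lattice b a)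
             ≡ Σ w (map (D ∷_) (paths schröder b a))
  diagonal = begin
    _ ≡⟨ Σ-shift (λ p → g (y ∷ crossings (suc y) p)) (λ p → valleys p C_) (paths lattice b a)
           (λ p → g (y ∷ crossings (suc y) p)) (δ ∘ diagonals) (paths schröder b a)
           (valleys-diagonals (g ∘ (y ∷_)) (suc y) b a) i ⟩
    Σ (λ p → g (y ∷ crossings (suc y) p) * shift (δ (diagonals p)) i) (paths schröder b a)
      ≡⟨ Σ-cong (λ p → cong (g (y ∷ crossings (suc y) p) *_) (δ-suc (diagonals p) i))
           (paths schröder b a) ⟨
    Σ (w ∘ (D ∷_)) (paths schröder b a)
      ≡⟨ Σ-map w (D ∷_) (paths schröder b a) ⟨
    Σ w (map (D ∷_) (paths schröder b a)) ∎
  east : Σ (u ∘ (E ∷_)) (paths lattice b (suc a)) + 0 ≡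
         Σ (w ∘ (E ∷_)) (paths schröder b (suc a)) + Σ w (map (D ∷_) (paths schröder b a))
  east = trans (+-identityʳ _)
    (trans (Σ-valleys-E∷ (λ p → g (y ∷ crossings y p)) i b a)
           (cong₂ _+_ (valleys-diagonals (g ∘ (y ∷_)) y b (suc a) i) diagonal))

valleys-sch : ∀ ν i → Σ (λ p → valleys p C i) (dyckPaths ν) ≡ sch ν i
valleys-sch ν i = begin
  Σ (λ p → valleys p C i) (dyckPaths ν)
    ≡⟨ Σ-filter (weaklyAbove? ν) _ (paths lattice (width ν) (height ν)) ⟩
  -- The weight is the indicator of lying weakly above `ν`, which depends on a path only through its
  -- crossings.
  _ ≡⟨ valleys-diagonals (λ cs → ⟦ decidable _≤?_ (crossings 0 ν) cs ⟧) 0 (width ν) (height ν) i ⟩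
  _ ≡⟨ Σ-filter (weaklyAbove? ν) _ (paths schröder (width ν) (height ν)) ⟨
  Σ (λ p → δ (diagonals p) i) (schröderPaths ν)
    ≡⟨ length-filter (λ p → diagonals p ≟ i) (schröderPaths ν) ⟨
  sch ν i ∎

-- Coefficients of a polynomial composed with x + 1.

coeff-map : ∀ c p i → coeff (map (c *_) p) i ≡ c * coeff p i
coeff-map c []      i       = sym (*-zeroʳ c)
coeff-map c (d ∷ p) zero    = refl
coeff-map c (d ∷ p) (suc i) = coeff-map c p i

coeff-+ₚ : ∀ p q i → coeff (p +ₚ q) i ≡ coeff p i + coeff q i
coeff-+ₚ []      q       i       = refl
coeff-+ₚ (c ∷ p) []      i       = sym (+-identityʳ _)
coeff-+ₚ (c ∷ p) (d ∷ q) zero    = refl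
coeff-+ₚ (c ∷ p) (d ∷ q) (suc i) = coeff-+ₚ p q i

coeff-0∷ : ∀ p i → coeff (0 ∷ p) i ≡ shift (coeff p) i
coeff-0∷ p zero    = refl
coeff-0∷ p (suc i) = refl

coeff-const : ∀ c i → coeff (const c) i ≡ c * (0 C i)
coeff-const c zero    = sym (*-identityʳ c)
coeff-const c (suc i) = sym (*-zeroʳ c)

shift-cong : ∀ {f g : ℕ → ℕ} → f ≗ g → shift f ≗ shift g
shift-cong f≗g zero    = refl
shift-cong f≗g (suc i) = f≗g i

coeff-[X+1]* : ∀ p i → coeff ((X +ₚ const 1) *ₚ p) i ≡ coeff p i + shift (coeff p) i
coeff-[X+1]* p i = begin
  -- `X +ₚ const 1` computes to `1 ∷ 1 ∷ []`, and the product unfolds accordingly; the inner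
  -- `0 ∷ []` is a trailing zero left by the empty tail.
  coeff (1p +ₚ (0 ∷ (1p +ₚ (0 ∷ [])))) i      ≡⟨ coeff-+ₚ 1p _ i ⟩
  coeff 1p i + coeff (0 ∷ (1p +ₚ (0 ∷ []))) i ≡⟨ cong₂ _+_ (coeff-1p i) (coeff-0∷ _ i) ⟩
  coeff p i + shift (coeff (1p +ₚ (0 ∷ []))) i ≡⟨ cong (coeff p i +_) (shift-cong eq i) ⟩
  coeff p i + shift (coeff p) i ∎
  where
  1p = map (1 *_) p
  coeff-1p : ∀ j → coeff 1p j ≡ coeff p j
  coeff-1p j = trans (coeff-map 1 p j) (*-identityˡ _)
  coeff-0 : ∀ j → coeff (0 ∷ []) j ≡ 0
  coeff-0 zero    = refl
  coeff-0 (suc j) = refl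
  eq : ∀ j → coeff (1p +ₚ (0 ∷ [])) j ≡ coeff p j
  eq j = trans (coeff-+ₚ 1p (0 ∷ []) j)
    (trans (cong₂ _+_ (coeff-1p j) (coeff-0 j)) (+-identityʳ _))

shift-Σ : ∀ (c : A → ℕ) (f : A → ℕ → ℕ) xs i →
  shift (λ j → Σ (λ x → c x * f x j) xs) i ≡ Σ (λ x → c x * shift (f x) i) xs
shift-Σ c f xs zero    = sym (Σ-zero _ (*-zeroʳ ∘ c) xs)
shift-Σ c f xs (suc i) = refl

-- Composition follows Horner's scheme: the composite of the tail is multiplied by x + 1, and
-- Pascal's rule turns each `j C i` into `suc j C i`.
coeff-⟨X+1⟩ : ∀ (f : ℕ → ℕ) n i →
  coeff (applyUpTo f n ⟨ X +ₚ const 1 ⟩) i ≡ Σ (λ j → f j * (j C i)) (upTo n)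
coeff-⟨X+1⟩ f zero    i = refl
coeff-⟨X+1⟩ f (suc n) i = begin
  coeff (const (f 0) +ₚ (X +ₚ const 1) *ₚ q) i
    ≡⟨ coeff-+ₚ (const (f 0)) ((X +ₚ const 1) *ₚ q) i ⟩
  coeff (const (f 0)) i + coeff ((X +ₚ const 1) *ₚ q) i
    ≡⟨ cong₂ _+_ (coeff-const (f 0) i) (coeff-[X+1]* q i) ⟩
  f 0 * (0 C i) + (coeff q i + shift (coeff q) i)
    ≡⟨ cong (f 0 * (0 C i) +_) (cong₂ _+_ (ih i) (trans (shift-cong ih i)
         (shift-Σ (f ∘ suc) _C_ (upTo n) i))) ⟩
  f 0 * (0 C i) + (Σ (λ j → f (suc j) * (j C i)) (upTo n) +
                   Σ (λ j → f (suc j) * shift (j C_) i) (upTo n))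
    ≡⟨ cong (f 0 * (0 C i) +_) (Σ-pascal (f ∘ suc) id i (upTo n)) ⟨
  f 0 * (0 C i) + Σ (λ j → f (suc j) * (suc j C i)) (upTo n)
    ≡⟨ Σ-upTo-suc (λ j → f j * (j C i)) n ⟨
  Σ (λ j → f j * (j C i)) (upTo (suc n)) ∎
  where
  q  = applyUpTo (f ∘ suc) n ⟨ X +ₚ const 1 ⟩
  ih = coeff-⟨X+1⟩ (f ∘ suc) n

-- Grouping Dyck paths by their number of valleys.

Σ-δ : ∀ (h : ℕ → ℕ) {m n} → m < n → Σ (λ j → δ m j * h j) (upTo n) ≡ h m
Σ-δ h {zero} {suc n} _ = begin
  _                                            ≡⟨ Σ-upTo-suc (λ j → δ 0 j * h j) n ⟩
  h 0 + 0 + Σ (λ j → δ 0 (suc j) * h (suc j)) (upTo n)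
    ≡⟨ cong₂ _+_ (+-identityʳ (h 0)) (Σ-zero _ (λ _ → refl) (upTo n)) ⟩
  h 0 + 0                                      ≡⟨ +-identityʳ (h 0) ⟩
  h 0                                          ∎
Σ-δ h {suc m} {suc n} (s≤s m<n) =
  -- The term at index 0 computes to 0, and the others are those of `δ m` and `h ∘ suc`.
  trans (Σ-upTo-suc (λ j → δ (suc m) j * h j) n) (Σ-δ (h ∘ suc) m<n)

-- Double counting: as `v x < n`, each `x` is counted at exactly one index `j`, namely `v x`, and so
-- contributes `h (v x)`.
Σ-fibres : ∀ (h : ℕ → ℕ) (v : A → ℕ) n xs → All (λ x → v x < n) xs →
  Σ (λ j → length (filter (λ x → v x ≟ j) xs) * h j) (upTo n) ≡ Σ (h ∘ v) xs
Σ-fibres h v n []       All.[]           = Σ-zero _ (λ _ → refl) (upTo n)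
Σ-fibres h v n (x ∷ xs) (v<n All.∷ vs<n) = begin
  Σ (λ j → length (filter (λ x → v x ≟ j) (x ∷ xs)) * h j) (upTo n)
    ≡⟨ Σ-cong split (upTo n) ⟩
  Σ (λ j → δ (v x) j * h j + length (filter (λ x → v x ≟ j) xs) * h j) (upTo n)
    ≡⟨ Σ-+ (λ j → δ (v x) j * h j) _ (upTo n) ⟩
  Σ (λ j → δ (v x) j * h j) (upTo n) + Σ (λ j → length (filter (λ x → v x ≟ j) xs) * h j) (upTo n)
    ≡⟨ cong₂ _+_ (Σ-δ h v<n) (Σ-fibres h v n xs vs<n) ⟩
  h (v x) + Σ (h ∘ v) xs ∎
  where
  split : ∀ j → length (filter (λ x → v x ≟ j) (x ∷ xs)) * h j ≡
                δ (v x) j * h j + length (filter (λ x → v x ≟ j) xs) * h j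
  split j = trans
    (cong (_* h j) (trans (length-filter (λ x → v x ≟ j) (x ∷ xs))
      (cong (δ (v x) j +_) (sym (length-filter (λ x → v x ≟ j) xs)))))
    (*-distribʳ-+ (h j) (δ (v x) j) _)

-- Each valley uses an E step, and a Dyck path has as many E steps as `ν`. Hence the cutoff in
-- `narayanaPoly` misses no Dyck path.
valleys-dyckPaths : ∀ ν → All (λ p → valleys p < suc (length ν)) (dyckPaths ν)
valleys-dyckPaths ν = All.tabulate λ {p} p∈ → s≤s (≤-trans (valleys≤width p)
  (≤-trans (≤-reflexive (proj₁ (∈-paths⁻ lattice (width ν) (height ν)
     (proj₁ (∈-filter⁻ (weaklyAbove? ν) {xs = paths lattice (width ν) (height ν)} p∈)))))
   (width≤length ν)))

proposition2p6 : ∀ (ν : LatticePath) →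
    narayanaPoly ν ⟨ X +ₚ const 1 ⟩ ≈ₚ schröderPoly ν
proposition2p6 ν i = begin
  coeff (narayanaPoly ν ⟨ X +ₚ const 1 ⟩) i
    ≡⟨ coeff-⟨X+1⟩ (Nar ν) (suc (length ν)) i ⟩
  Σ (λ j → Nar ν j * (j C i)) (upTo (suc (length ν)))
    ≡⟨ Σ-fibres (_C i) valleys (suc (length ν)) (dyckPaths ν) (valleys-dyckPaths ν) ⟩
  Σ (λ p → valleys p C i) (dyckPaths ν)
    ≡⟨ valleys-sch ν i ⟩
  sch ν i
    ≡⟨ coeff-schröderPoly ν i ⟨
  coeff (schröderPoly ν) i ∎
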